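{- Let $\Delta$ be a positive integer, let $m\in\{1,2,3\}$ and let $a,b\in\mathbb{Z}^m$ be such that $M(a,b)$ is a generic $\Delta$-submodular matrix of type $m$. Then the number of columns of $M(a,b)$ is at most $\Delta+4$ if $\Delta\equiv 2\bmod 6$, at most $\Delta+3$ if $\Delta\equiv 1,3,5\bmod 6$, and at most $\Delta+2$ if $\Delta\equiv 0,4\bmod 6$.
   Context: All matrices are integer matrices with pairwise distinct columns. For $A\in\mathbb{Z}^{2\times n}$ of rank $2$, $A$ is $\Delta$-submodular if all its $2\times 2$ minors have absolute value at most $\Delta$, and generic if any two columns are linearly independent. For $a,b\in\mathbb{Z}^m$, $M(a,b)$ (a matrix of type $m$) is the $2$-row matrix whose columns are $(0,1)^\intercal$ together with all $(k,j)^\intercal$ with $k\in\{1,\dots,m\}$, $a_k\leq j\leq b_k$, $\gcd(j,k)=1$. -}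

module Defs where

open import Data.Nat as ℕ using (ℕ; zero; suc)
open import Data.Integer as ℤ using (ℤ; +_; _-_; _*_; ∣_∣)
open import Data.Integer.GCD using (gcd)
open import Data.Fin using (Fin; toℕ)
open import Data.List using (List; []; _∷_; _++_; map; filter; upTo; length; lookup; concatMap)
open import Data.Product using (_×_; _,_; ∃₂)
open import Relation.Nullary using (¬_; does; yes; no)
open import Data.Bool using (true; false)
open import Data.Fin using (fromℕ<)
open import Relation.Binary.PropositionalEquality using (_≡_; _≢_)

Col : Set
Col = ℤ × ℤ

det : Col → Col → ℤ
det (x₁ , y₁) (x₂ , y₂) = x₁ * y₂ - x₂ * y₁

intRange : ℤ → ℤ → List ℤ
intRange a b with does (a ℤ.≤? b)
... | true  = map (λ i → a ℤ.+ + i) (upTo (suc ∣ b - a ∣))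
... | false = []

colsAt : ℕ → ℤ → ℤ → List Col
colsAt k a b =
  map (λ j → (+ k , j)) (filter (λ j → gcd j (+ k) ℤ.≟ ℤ.1ℤ) (intRange a b))

colsUpTo : (m : ℕ) → (a b : Fin m → ℤ) → List Col
colsUpTo m a b = go m
  where
  go : ℕ → List Col
  go zero = []
  go (suc i) with i ℕ.<? m
  ... | yes p = go i ++ colsAt (suc i) (a (fromℕ< p)) (b (fromℕ< p))
  ... | no _ = go i

-- The matrix M(a,b) of type m, as its list of columns:
-- (0,1) followed by all (k,j), 1 ≤ k ≤ m, a_k ≤ j ≤ b_k, gcd(j,k) = 1.
-- (a k is stored at index k-1.)
M : (m : ℕ) → (a b : Fin m → ℤ) → List Col
M m a b = (+ 0 , + 1) ∷ colsUpTo m a b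

ncols : List Col → ℕ
ncols = length

Rank2 : List Col → Set
Rank2 A = ∃₂ λ (i j : Fin (length A)) → det (lookup A i) (lookup A j) ≢ + 0

Submodular : ℕ → List Col → Set
Submodular Δ A =
  Rank2 A × ((i j : Fin (length A)) → ∣ det (lookup A i) (lookup A j) ∣ ℕ.≤ Δ)

Generic : List Col → Set
Generic A = (i j : Fin (length A)) → i ≢ j → det (lookup A i) (lookup A j) ≢ + 0

-- Apart from (0,1), the columns of M(a,b) form rows k = 1, 2, 3, the row k consisting of the (k, j)
-- with j ∈ [a_k, b_k] prime to k. A potential Φₖ that grows by k exactly at the integers prime to k
-- counts a row: k times its number of columns is Φₖ (x₁ + 1) − Φₖ x₀ for its extreme entries x₀, x₁.
-- Every 2×2 minor of the extreme columns of the rows and of (0,1) is at most Δ, and for each set of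
-- nonempty rows a nonnegative combination of these inequalities and of the counts bounds the number
-- of columns by Δ + 2, or by Δ + 3 if just rows 1 and 2 occur and Δ is odd. When all three rows occur,
-- the minors det((1,p),(3,z₁)) and det((2,y₀),(3,z₁)) are prime to 3 and odd respectively, with sum
-- divisible by 3; comparing their residues with that of Δ modulo 6 yields the excess β (Δ mod 6),
-- and so do the minors at the other ends of the rows.
module Submission where

open import Defs
open import Data.Bool using (Bool; true; false; not; if_then_else_)
open import Data.Bool.Properties using (not-injective) renaming (_≟_ to _≟ᵇ_)
open import Data.Fin using (Fin) renaming (zero to fzero; suc to fsuc)
open import Data.Integer as ℤ using (ℤ; +_; _+_; _-_; _*_; -_; ∣_∣; 0ℤ; 1ℤ; _≤_; +≤+)
import Data.Integer.Properties as ℤP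
import Data.Integer.DivMod as ℤDM
open import Data.Integer.Divisibility.Signed as ℤD using () renaming (_∣?_ to _∣ℤ?_; _∣_ to _∣ℤ_)
open import Data.Integer.Tactic.RingSolver using (solve-∀; solve)
open import Data.Nat as ℕ using (ℕ; zero; suc; NonZero; z≤n; s≤s)
import Data.Nat.Properties as ℕP
open import Data.Nat.Divisibility as ℕD using (divides)
open import Data.Nat.DivMod using (m≡m%n+[m/n]*n; m%n<n)
import Data.Nat.GCD as ℕG
open import Data.Nat.Primality using (Prime; prime?; prime[2]; prime⇒irreducible; prime⇒nonTrivial)
open import Data.Integer.GCD using (gcd; gcd-zeroʳ)
open import Data.List using (List; []; _∷_; _++_; filter; length; applyUpTo)
import Data.List.Properties as LP
open import Data.List.Relation.Unary.Any using (here; there; index)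
open import Data.List.Relation.Unary.Any.Properties using (lookup-index)
open import Data.List.Membership.Propositional using (_∈_)
open import Data.List.Membership.Propositional.Properties
  using (∈-applyUpTo⁺; ∈-filter⁺; ∈-filter⁻; ∈-map⁺; ∈-++⁺ˡ; ∈-++⁺ʳ)
open import Data.Product using (∃; ∃₂; _×_; _,_; proj₂)
open import Function using (_∘_; _$_)
open import Data.Sum using (_⊎_; inj₁; inj₂; [_,_]′)
open import Data.Empty using (⊥-elim)
open import Relation.Binary.PropositionalEquality
open import Relation.Nullary using (Dec; yes; no; does; ¬_)
open import Relation.Nullary.Decidable using (True; toWitness; from-yes; _⊎-dec_; _→-dec_; does-⇔; dec-true; dec-false)
open import Function.Bundles using (mk⇔)
open import Relation.Unary using (Decidable)

-- Linear integer arithmetic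

Natural : ℤ → Set
Natural x = ∃ λ n → x ≡ + n

natural-+ : ∀ {x y} → Natural x → Natural y → Natural (x + y)
natural-+ (m , refl) (n , refl) = m ℕ.+ n , sym (ℤP.pos-+ m n)

natural-* : ∀ k {x} → Natural x → Natural (+ k * x)
natural-* k (n , refl) = k ℕ.* n , sym (ℤP.pos-* k n)

natural-≤ : ∀ {x y} → x ≤ y → Natural (y - x)
natural-≤ {x} {y} x≤y = ∣ y - x ∣ , sym (ℤP.0≤i⇒+∣i∣≡i (ℤP.i≤j⇒0≤j-i x≤y))

≤-by-natural : ∀ {x y} e → Natural e → y - x ≡ e → x ≤ y
≤-by-natural e (n , refl) y-x≡e = ℤP.0≤i-j⇒j≤i (subst (0ℤ ≤_) (sym y-x≡e) (+≤+ z≤n))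

-- Linear inequalities are proved from a certificate: a ring identity writing y − x as a natural
-- number e plus a combination d of the hypotheses' equations, which vanishes.
≤-by-certificate : ∀ {x y} e d → Natural e → d ≡ 0ℤ → y - x ≡ e + d → x ≤ y
≤-by-certificate e d e≥0 refl y-x≡e+d = ≤-by-natural e e≥0 (trans y-x≡e+d (ℤP.+-identityʳ e))

≤-by-scaling : ∀ k {n b : ℕ} → + suc k * + n ≤ + suc k * + b + + k → n ℕ.≤ b
≤-by-scaling k {n} {b} h = ℕP.m<1+n⇒m≤n (ℕP.*-cancelˡ-< (suc k) n (suc b) (begin-strict
    suc k ℕ.* n            ≤⟨ ℤP.drop‿+≤+ (subst₂ _≤_ (sym (ℤP.pos-* (suc k) n)) (sym (ℤP.pos-+ _ k))
                                (subst (λ t → + suc k * + n ≤ t + + k) (sym (ℤP.pos-* (suc k) b)) h)) ⟩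
    suc k ℕ.* b ℕ.+ k      <⟨ ℕP.+-monoʳ-< (suc k ℕ.* b) (ℕP.n<1+n k) ⟩
    suc k ℕ.* b ℕ.+ suc k  ≡⟨ ℕP.+-comm (suc k ℕ.* b) (suc k) ⟩
    suc k ℕ.+ suc k ℕ.* b  ≡⟨ ℕP.*-suc (suc k) b ⟨
    suc k ℕ.* suc b        ∎))
  where open ℕP.≤-Reasoning

≰⇒+1≤ : ∀ {x y} → ¬ x ≤ y → y + 1ℤ ≤ x
≰⇒+1≤ {x} {y} x≰y = subst (_≤ x) (ℤP.+-comm 1ℤ y) (ℤP.i<j⇒suc[i]≤j (ℤP.≰⇒> x≰y))

i+[j-i]≡j : ∀ i j → i + (j - i) ≡ j
i+[j-i]≡j = solve-∀

i-1+1≡i : ∀ i → i - 1ℤ + 1ℤ ≡ i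
i-1+1≡i = solve-∀

i≤j⇒+∣j-i∣≡j-i : ∀ {i j} → i ≤ j → + ∣ j - i ∣ ≡ j - i
i≤j⇒+∣j-i∣≡j-i i≤j = ℤP.0≤i⇒+∣i∣≡i (ℤP.i≤j⇒0≤j-i i≤j)

i≤+∣i∣ : ∀ i → i ≤ + ∣ i ∣
i≤+∣i∣ (+ n)      = ℤP.≤-refl
i≤+∣i∣ ℤ.-[1+ n ] = ℤ.-≤+

-- Residues and divisibility

infix 4 _≡_[mod_]
_≡_[mod_] : ℤ → ℕ → ℕ → Set
x ≡ r [mod m ] = ∃ λ q → x ≡ + r + q * + m

residue : ∀ m .{{_ : NonZero m}} x → ∃ λ r → r ℕ.< m × x ≡ r [mod m ]
residue m x = x ℤDM.% + m , ℤDM.n%d<d x (+ m) , x ℤDM./ + m , ℤDM.a≡a%n+[a/n]*n x (+ m)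

ℕ-residue : ∀ m .{{_ : NonZero m}} n → + n ≡ n ℕ.% m [mod m ]
ℕ-residue m n = + (n ℕ./ m) , (begin
  + n                                  ≡⟨ cong +_ (m≡m%n+[m/n]*n n m) ⟩
  + (n ℕ.% m ℕ.+ n ℕ./ m ℕ.* m)       ≡⟨ ℤP.pos-+ (n ℕ.% m) _ ⟩
  + (n ℕ.% m) + + (n ℕ./ m ℕ.* m)     ≡⟨ cong (λ t → + (n ℕ.% m) + t) (ℤP.pos-* (n ℕ./ m) m) ⟩
  + (n ℕ.% m) + + (n ℕ./ m) * + m     ∎)
  where open ≡-Reasoning

mod-+ : ∀ {m x y r s} → x ≡ r [mod m ] → y ≡ s [mod m ] → x + y ≡ r ℕ.+ s [mod m ]
mod-+ {m} {r = r} {s} (q , refl) (q′ , refl) =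
  q + q′ , trans (shuffle (+ r) (+ s) q q′ (+ m)) (cong (_+ (q + q′) * + m) (sym (ℤP.pos-+ r s)))
  where
  shuffle : ∀ r s q q′ m → r + q * m + (s + q′ * m) ≡ r + s + (q + q′) * m
  shuffle = solve-∀

mod-+ℕ : ∀ {m x r} i → x ≡ r [mod m ] → x + + i ≡ r ℕ.+ i [mod m ]
mod-+ℕ i x≡r = mod-+ x≡r (0ℤ , sym (ℤP.+-identityʳ (+ i)))

mod-neg : ∀ {m y s} → y ≡ s [mod m ] → s ℕ.≤ m → - y ≡ m ℕ.∸ s [mod m ]
mod-neg {m} {s = s} (q , refl) s≤m = - q - 1ℤ , (begin
  - (+ s + q * + m)                        ≡⟨ cong (λ t → - (+ s + q * t)) (sym m∸s+s) ⟩
  - (+ s + q * (w + + s))                  ≡⟨ regroup (+ s) q w ⟩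
  w + (- q - 1ℤ) * (w + + s)               ≡⟨ cong (λ t → w + (- q - 1ℤ) * t) m∸s+s ⟩
  w + (- q - 1ℤ) * + m                     ∎)
  where
  open ≡-Reasoning
  w : ℤ
  w = + (m ℕ.∸ s)
  m∸s+s : w + + s ≡ + m
  m∸s+s = cong +_ (ℕP.m∸n+n≡m s≤m)
  regroup : ∀ s q w → - (s + q * (w + s)) ≡ w + (- q - 1ℤ) * (w + s)
  regroup = solve-∀

mod-∸ : ∀ {m x y r s} → x ≡ r [mod m ] → y ≡ s [mod m ] → s ℕ.≤ m → x - y ≡ r ℕ.+ (m ℕ.∸ s) [mod m ]
mod-∸ x≡r y≡s s≤m = mod-+ x≡r (mod-neg y≡s s≤m)

mod-% : ∀ {m x r} .{{_ : NonZero m}} → x ≡ r [mod m ] → x ≡ r ℕ.% m [mod m ]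
mod-% {m} {r = r} (q , refl) with ℕ-residue m r
... | q′ , r≡ = q′ + q , trans (cong (_+ q * + m) r≡) (regroup (+ (r ℕ.% m)) q′ q (+ m))
  where
  regroup : ∀ a q′ q m → a + q′ * m + q * m ≡ a + (q′ + q) * m
  regroup = solve-∀

least-residue : ∀ {m x r} → x ≡ r [mod m ] → r ℕ.< m → 0ℤ ≤ x → + r ≤ x
least-residue {m} {r = r} (+ n , refl) _ _ =
  ≤-by-natural (+ n * + m) (natural-* n (m , refl)) (difference (+ r) (+ m) (+ n))
  where
  difference : ∀ r m n → r + n * m - r ≡ n * m
  difference = solve-∀
least-residue {m} {r = r} (ℤ.-[1+ n ] , refl) r<m 0≤x =
  ⊥-elim (ℕP.<⇒≱ r<m (ℤP.drop‿+≤+ (≤-by-natural _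
    (natural-+ (natural-≤ 0≤x) (natural-* n (m , refl))) (difference (+ r) (+ m) (+ n)))))
  where
  difference : ∀ r m n → r - m ≡ r + (- (1ℤ + n)) * m - 0ℤ + n * m
  difference = solve-∀

infix 5 _∣ᵇ_
_∣ᵇ_ : ℕ → ℤ → Bool
k ∣ᵇ x = does (+ k ∣ℤ? x)

∣ᵇ-+-multiple : ∀ k y {d} → + k ∣ℤ d → k ∣ᵇ (y + d) ≡ k ∣ᵇ y
∣ᵇ-+-multiple k y {d} k∣d =
  does-⇔ (mk⇔ (λ k∣y+d → ℤD.∣m+n∣n⇒∣m k∣y+d k∣d) (λ k∣y → ℤD.∣m∣n⇒∣m+n k∣y k∣d)) (+ k ∣ℤ? (y + d)) (+ k ∣ℤ? y)

∣ᵇ-residue : ∀ {k m x r} → k ℕD.∣ m → x ≡ r [mod m ] → k ∣ᵇ x ≡ k ∣ᵇ + r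
∣ᵇ-residue {r = r} k∣m (q , refl) = ∣ᵇ-+-multiple _ (+ r) (ℤD.∣n⇒∣m*n q (ℤD.∣ᵤ⇒∣ k∣m))

∣ᵇ-congruent : ∀ k {x} y t → x ≡ y + + k * t → k ∣ᵇ x ≡ k ∣ᵇ y
∣ᵇ-congruent k y t refl = ∣ᵇ-+-multiple k y (ℤD.∣m⇒∣m*n t ℤD.∣-refl)

∣ᵇ-neg : ∀ k x → k ∣ᵇ (- x) ≡ k ∣ᵇ x
∣ᵇ-neg k x = does-⇔ (mk⇔ (λ k∣-x → subst (+ k ∣ℤ_) (ℤP.neg-involutive x) (ℤD.∣m⇒∣-m k∣-x)) ℤD.∣m⇒∣-m)
                    (+ k ∣ℤ? (- x)) (+ k ∣ℤ? x)

∣ᵇ-multiple : ∀ k t → k ∣ᵇ (+ k * t) ≡ true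
∣ᵇ-multiple k t = dec-true (+ k ∣ℤ? (+ k * t)) (ℤD.∣m⇒∣m*n t ℤD.∣-refl)

𝟙 : Bool → ℕ
𝟙 true  = 1
𝟙 false = 0

-- A decidable property of the residues 0, …, 5 is established by evaluation.
all-residues : ∀ {P : ℕ → Set} (P? : Decidable P) {holds : True (ℕP.allUpTo? P? 6)} → ∀ {r} → r ℕ.< 6 → P r
all-residues P? {holds} = toWitness holds

2∣6 : 2 ℕD.∣ 6
2∣6 = divides 3 refl

3∣6 : 3 ℕD.∣ 6
3∣6 = divides 2 refl

one-in-two : ∀ x → 𝟙 (2 ∣ᵇ x) ℕ.+ 𝟙 (2 ∣ᵇ (x + 1ℤ)) ≡ 1
one-in-two x with residue 6 x
... | r , r<6 , x≡r =
  trans (cong₂ (λ b₀ b₁ → 𝟙 b₀ ℕ.+ 𝟙 b₁) (∣ᵇ-residue 2∣6 x≡r) (∣ᵇ-residue 2∣6 (mod-+ℕ 1 x≡r)))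
        (all-residues (λ r → 𝟙 (2 ∣ᵇ + r) ℕ.+ 𝟙 (2 ∣ᵇ (+ r + 1ℤ)) ℕ.≟ 1) r<6)

one-in-three : ∀ x → 𝟙 (3 ∣ᵇ x) ℕ.+ 𝟙 (3 ∣ᵇ (x + 1ℤ)) ℕ.+ 𝟙 (3 ∣ᵇ (x + 1ℤ + 1ℤ)) ≡ 1
one-in-three x with residue 6 x
... | r , r<6 , x≡r =
  trans (cong₃ (λ b₀ b₁ b₂ → 𝟙 b₀ ℕ.+ 𝟙 b₁ ℕ.+ 𝟙 b₂)
          (∣ᵇ-residue 3∣6 x≡r) (∣ᵇ-residue 3∣6 (mod-+ℕ 1 x≡r)) (∣ᵇ-residue 3∣6 (mod-+ℕ 1 (mod-+ℕ 1 x≡r))))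
        (all-residues (λ r → 𝟙 (3 ∣ᵇ + r) ℕ.+ 𝟙 (3 ∣ᵇ (+ r + 1ℤ)) ℕ.+ 𝟙 (3 ∣ᵇ (+ r + 1ℤ + 1ℤ)) ℕ.≟ 1) r<6)
  where
  cong₃ : ∀ {A B C D : Set} (f : A → B → C → D) {a a′ b b′ c c′} →
    a ≡ a′ → b ≡ b′ → c ≡ c′ → f a b c ≡ f a′ b′ c′
  cong₃ f refl refl refl = refl

parity-alternates : ∀ x → 2 ∣ᵇ (x + 1ℤ) ≡ not (2 ∣ᵇ x)
parity-alternates x = alternate (2 ∣ᵇ x) (2 ∣ᵇ (x + 1ℤ)) (one-in-two x)
  where
  alternate : ∀ b₀ b₁ → 𝟙 b₀ ℕ.+ 𝟙 b₁ ≡ 1 → b₁ ≡ not b₀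
  alternate true  false _ = refl
  alternate false true  _ = refl

multiple₃-then-not : ∀ x → 3 ∣ᵇ x ≡ true → 3 ∣ᵇ (x + 1ℤ) ≡ false
multiple₃-then-not x = exclusive (3 ∣ᵇ x) (3 ∣ᵇ (x + 1ℤ)) (3 ∣ᵇ (x + 1ℤ + 1ℤ)) (one-in-three x)
  where
  exclusive : ∀ b₀ b₁ b₂ → 𝟙 b₀ ℕ.+ 𝟙 b₁ ℕ.+ 𝟙 b₂ ≡ 1 → b₀ ≡ true → b₁ ≡ false
  exclusive true false _ _ _ = refl

does-true⇒ : ∀ {A : Set} (a? : Dec A) → does a? ≡ true → A
does-true⇒ (yes a) _ = a

Coprime : ℕ → ℤ → Set
Coprime k x = gcd x (+ k) ≡ 1ℤ

coprime? : ∀ k → Decidable (Coprime k)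
coprime? k x = gcd x (+ k) ℤ.≟ 1ℤ

coprimeᵇ : ℕ → ℤ → Bool
coprimeᵇ k x = does (coprime? k x)

coprimeᵇ-1 : ∀ x → coprimeᵇ 1 x ≡ true
coprimeᵇ-1 x = dec-true (gcd x 1ℤ ℤ.≟ 1ℤ) (gcd-zeroʳ x)

coprimeᵇ-prime : ∀ {p} → Prime p → ∀ x → coprimeᵇ p x ≡ not (p ∣ᵇ x)
coprimeᵇ-prime {p} p-prime x = by-divisibility (+ p ∣ℤ? x)
  where
  instance
    p-nonTrivial : ℕ.NonTrivial p
    p-nonTrivial = prime⇒nonTrivial p-prime
  by-divisibility : (d : Dec (+ p ∣ℤ x)) → coprimeᵇ p x ≡ not (does d)
  by-divisibility (yes p∣x) = dec-false (gcd x (+ p) ℤ.≟ 1ℤ) λ gcd≡1 →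
    ℕ.nonTrivial⇒≢1 (ℕD.∣1⇒≡1 (subst (p ℕD.∣_) (ℤP.+-injective gcd≡1)
                                    (ℕG.gcd-greatest (ℤD.∣⇒∣ᵤ p∣x) ℕD.∣-refl)))
  by-divisibility (no p∤x) = dec-true (gcd x (+ p) ℤ.≟ 1ℤ)
    (cong +_ (one-or-p (prime⇒irreducible p-prime (ℕG.gcd[m,n]∣n (∣ x ∣) p))))
    where
    one-or-p : ℕG.gcd (∣ x ∣) p ≡ 1 ⊎ ℕG.gcd (∣ x ∣) p ≡ p → ℕG.gcd (∣ x ∣) p ≡ 1
    one-or-p (inj₁ g≡1) = g≡1
    one-or-p (inj₂ g≡p) = ⊥-elim (p∤x (ℤD.∣ᵤ⇒∣ (subst (ℕD._∣ ∣ x ∣) g≡p (ℕG.gcd[m,n]∣m (∣ x ∣) p))))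

prime[3] : Prime 3
prime[3] = from-yes (prime? 3)

coprime⇒∤ : ∀ {p} x → Prime p → Coprime p x → p ∣ᵇ x ≡ false
coprime⇒∤ {p} x p-prime coprime = not-injective (trans (sym (coprimeᵇ-prime p-prime x)) (dec-true (coprime? p x) coprime))

coprime-after-multiple : ∀ {p} → Prime p → (∀ x → p ∣ᵇ x ≡ true → p ∣ᵇ (x + 1ℤ) ≡ false) →
  ∀ x → ¬ Coprime p x → Coprime p (x + 1ℤ)
coprime-after-multiple {p} p-prime next-not-multiple x ¬coprime =
  does-true⇒ (coprime? p (x + 1ℤ)) (trans (coprimeᵇ-prime p-prime (x + 1ℤ)) (cong not (next-not-multiple x p∣x)))
  where
  p∣x : p ∣ᵇ x ≡ true
  p∣x = not-injective (trans (sym (coprimeᵇ-prime p-prime x)) (dec-false (coprime? p x) ¬coprime))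

-- Counting the integers of a range prime to k

length-filter-∷ : ∀ {P : ℤ → Set} (P? : Decidable P) x xs →
  length (filter P? (x ∷ xs)) ≡ 𝟙 (does (P? x)) ℕ.+ length (filter P? xs)
length-filter-∷ P? x xs with does (P? x)
... | true  = refl
... | false = refl

intRange-nonempty : ∀ {a b} → a ≤ b → intRange a b ≡ applyUpTo (λ i → a + + i) (suc ∣ b - a ∣)
intRange-nonempty {a} {b} a≤b with a ℤ.≤? b
... | yes _   = LP.map-upTo (λ i → a + + i) (suc ∣ b - a ∣)
... | no a≰b = ⊥-elim (a≰b a≤b)

intRange-empty : ∀ {a b} → ¬ a ≤ b → intRange a b ≡ []
intRange-empty {a} {b} a≰b with a ℤ.≤? b
... | yes a≤b = ⊥-elim (a≰b a≤b)
... | no _    = refl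

∈-intRange : ∀ {a b x} → a ≤ x → x ≤ b → x ∈ intRange a b
∈-intRange {a} {b} {x} a≤x x≤b rewrite intRange-nonempty (ℤP.≤-trans a≤x x≤b) =
  subst (_∈ applyUpTo (λ i → a + + i) (suc ∣ b - a ∣)) a+[x-a]≡x
    (∈-applyUpTo⁺ (λ i → a + + i) (s≤s (ℤP.drop‿+≤+ x-a≤b-a)))
  where
  x-a≤b-a : + ∣ x - a ∣ ≤ + ∣ b - a ∣
  x-a≤b-a = subst₂ _≤_ (sym (i≤j⇒+∣j-i∣≡j-i a≤x)) (sym (i≤j⇒+∣j-i∣≡j-i (ℤP.≤-trans a≤x x≤b))) (ℤP.+-monoˡ-≤ (- a) x≤b)
  a+[x-a]≡x : a + + ∣ x - a ∣ ≡ x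
  a+[x-a]≡x = trans (cong (λ t → a + t) (i≤j⇒+∣j-i∣≡j-i a≤x)) (i+[j-i]≡j a x)

module Counting {P : ℤ → Set} (P? : Decidable P) (c : ℕ) (Φ : ℤ → ℤ)
                (Φ-step : ∀ x → Φ (x + 1ℤ) ≡ Φ x + + c * + 𝟙 (does (P? x))) where

  Φ-increment : ∀ x → + c * + 𝟙 (does (P? x)) ≡ Φ (x + 1ℤ) - Φ x
  Φ-increment x = trans (solve-for (Φ x) (+ c * + 𝟙 (does (P? x)))) (cong (_- Φ x) (sym (Φ-step x)))
    where
    solve-for : ∀ y d → d ≡ y + d - y
    solve-for = solve-∀

  count-applyUpTo : ∀ n a (f : ℕ → ℤ) → (∀ i → f i ≡ a + + i) →
    + c * + length (filter P? (applyUpTo f n)) ≡ Φ (a + + n) - Φ a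
  count-applyUpTo zero a f _ = begin
    + c * 0ℤ         ≡⟨ ℤP.*-zeroʳ (+ c) ⟩
    0ℤ               ≡⟨ ℤP.+-inverseʳ (Φ a) ⟨
    Φ a - Φ a        ≡⟨ cong (λ t → Φ t - Φ a) (ℤP.+-identityʳ a) ⟨
    Φ (a + 0ℤ) - Φ a ∎
    where open ≡-Reasoning
  count-applyUpTo (suc n) a f f≗ = begin
    + c * + length (filter P? (f 0 ∷ applyUpTo (f ∘ suc) n))
      ≡⟨ cong (λ l → + c * + l) (length-filter-∷ P? (f 0) _) ⟩
    + c * + (𝟙 (does (P? (f 0))) ℕ.+ L)
      ≡⟨ cong (+ c *_) (ℤP.pos-+ (𝟙 (does (P? (f 0)))) L) ⟩
    + c * (+ 𝟙 (does (P? (f 0))) + + L)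
      ≡⟨ ℤP.*-distribˡ-+ (+ c) _ (+ L) ⟩
    + c * + 𝟙 (does (P? (f 0))) + + c * + L
      ≡⟨ cong₂ _+_ (trans (cong (λ y → + c * + 𝟙 (does (P? y))) f0≡a) (Φ-increment a))
                   (count-applyUpTo n (a + 1ℤ) (f ∘ suc) (λ i → trans (f≗ (suc i)) (shift a (+ i)))) ⟩
    (Φ (a + 1ℤ) - Φ a) + (Φ (a + 1ℤ + + n) - Φ (a + 1ℤ))
      ≡⟨ telescope (Φ a) (Φ (a + 1ℤ)) (Φ (a + 1ℤ + + n)) ⟩
    Φ (a + 1ℤ + + n) - Φ a
      ≡⟨ cong (λ t → Φ t - Φ a) (shift a (+ n)) ⟨
    Φ (a + + suc n) - Φ a ∎
    where
    open ≡-Reasoning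
    L : ℕ
    L = length (filter P? (applyUpTo (f ∘ suc) n))
    f0≡a : f 0 ≡ a
    f0≡a = trans (f≗ 0) (ℤP.+-identityʳ a)
    shift : ∀ a i → a + (1ℤ + i) ≡ a + 1ℤ + i
    shift = solve-∀
    telescope : ∀ x y z → (y - x) + (z - y) ≡ z - x
    telescope = solve-∀

  count : ∀ {a b} → a ≤ b → + c * + length (filter P? (intRange a b)) ≡ Φ (b + 1ℤ) - Φ a
  count {a} {b} a≤b rewrite intRange-nonempty a≤b =
    trans (count-applyUpTo (suc ∣ b - a ∣) a (λ i → a + + i) (λ _ → refl))
          (cong (λ t → Φ t - Φ a) a+[1+b-a]≡b+1)
    where
    a+[1+b-a]≡b+1 : a + (1ℤ + + ∣ b - a ∣) ≡ b + 1ℤ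
    a+[1+b-a]≡b+1 = trans (cong (λ t → a + (1ℤ + t)) (i≤j⇒+∣j-i∣≡j-i a≤b)) (cancel a b)
      where
      cancel : ∀ a b → a + (1ℤ + (b - a)) ≡ b + 1ℤ
      cancel = solve-∀

  Φ-mono-+ : ∀ x n → Φ x ≤ Φ (x + + n)
  Φ-mono-+ x zero = ℤP.≤-reflexive (cong Φ (sym (ℤP.+-identityʳ x)))
  Φ-mono-+ x (suc n) = ℤP.≤-trans (Φ-mono-+ x n) (subst (Φ (x + + n) ≤_) Φ-next Φ≤Φ+increment)
    where
    Φ≤Φ+increment : Φ (x + + n) ≤ Φ (x + + n) + + c * + 𝟙 (does (P? (x + + n)))
    Φ≤Φ+increment = ≤-by-natural _ (natural-* c (_ , refl)) (difference (Φ (x + + n)) _)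
      where
      difference : ∀ y d → y + d - y ≡ d
      difference = solve-∀
    Φ-next : Φ (x + + n) + + c * + 𝟙 (does (P? (x + + n))) ≡ Φ (x + + suc n)
    Φ-next = trans (sym (Φ-step (x + + n))) (cong Φ (regroup x (+ n)))
      where
      regroup : ∀ x n → x + n + 1ℤ ≡ x + (1ℤ + n)
      regroup = solve-∀

  Φ-mono : ∀ {x y} → x ≤ y → Φ x ≤ Φ y
  Φ-mono {x} {y} x≤y = subst (λ t → Φ x ≤ Φ t) x+[y-x]≡y (Φ-mono-+ x ∣ y - x ∣)
    where
    x+[y-x]≡y : x + + ∣ y - x ∣ ≡ y
    x+[y-x]≡y = trans (cong (λ t → x + t) (i≤j⇒+∣j-i∣≡j-i x≤y)) (i+[j-i]≡j x y)

  Φ-step-reject : ∀ {x} → ¬ P x → Φ (x + 1ℤ) ≡ Φ x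
  Φ-step-reject {x} ¬Px = trans (Φ-step x) (trans (cong (λ b → Φ x + + c * + 𝟙 b) (dec-false (P? x) ¬Px))
                                                 (trans (cong (λ t → Φ x + t) (ℤP.*-zeroʳ (+ c))) (ℤP.+-identityʳ (Φ x))))

  module _ .{{_ : NonZero c}} (no-gap : ∀ x → ¬ P x → P (x + 1ℤ)) where

    first-from : ∀ a → ∃ λ x₀ → P x₀ × a ≤ x₀ × Φ x₀ ≡ Φ a
    first-from a with P? a
    ... | yes Pa = a , Pa , ℤP.≤-refl , refl
    ... | no ¬Pa = a + 1ℤ , no-gap a ¬Pa , ℤP.i≤i+j a 1ℤ , Φ-step-reject ¬Pa

    last-upto : ∀ b → ∃ λ x₁ → P x₁ × x₁ ≤ b × Φ (x₁ + 1ℤ) ≡ Φ (b + 1ℤ)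
    last-upto b with P? b | P? (b - 1ℤ)
    ... | yes Pb  | _        = b , Pb , ℤP.≤-refl , refl
    ... | no ¬Pb | yes Pb-1 = b - 1ℤ , Pb-1 , ℤP.i-j≤i b 1ℤ , trans (cong Φ (i-1+1≡i b)) (sym (Φ-step-reject ¬Pb))
    ... | no ¬Pb | no ¬Pb-1 = ⊥-elim (¬Pb (subst P (i-1+1≡i b) (no-gap (b - 1ℤ) ¬Pb-1)))

    extremes : ∀ a b → let S = filter P? (intRange a b) in
      length S ≡ 0 ⊎ ∃₂ λ x₀ x₁ → x₀ ∈ S × x₁ ∈ S × + c * + length S ≡ Φ (x₁ + 1ℤ) - Φ x₀
    extremes a b = by-order (a ℤ.≤? b)
      where
      S : List ℤ
      S = filter P? (intRange a b)
      Conclusion : Set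
      Conclusion = length S ≡ 0 ⊎ ∃₂ λ x₀ x₁ → x₀ ∈ S × x₁ ∈ S × + c * + length S ≡ Φ (x₁ + 1ℤ) - Φ x₀
      by-order : Dec (a ≤ b) → Conclusion
      by-order (no a≰b) = inj₁ (cong (length ∘ filter P?) (intRange-empty a≰b))
      by-order (yes a≤b) with first-from a | last-upto b
      ... | x₀ , Px₀ , a≤x₀ , Φx₀≡Φa | x₁ , Px₁ , x₁≤b , Φx₁+1≡Φb+1 = by-extremes (x₀ ℤ.≤? x₁)
        where
        count-extremes : + c * + length S ≡ Φ (x₁ + 1ℤ) - Φ x₀
        count-extremes = trans (count a≤b) (cong₂ _-_ (sym Φx₁+1≡Φb+1) (sym Φx₀≡Φa))
        by-extremes : Dec (x₀ ≤ x₁) → Conclusion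
        by-extremes (yes x₀≤x₁) = inj₂ (x₀ , x₁ ,
          ∈-filter⁺ P? (∈-intRange a≤x₀ (ℤP.≤-trans x₀≤x₁ x₁≤b)) Px₀ ,
          ∈-filter⁺ P? (∈-intRange (ℤP.≤-trans a≤x₀ x₀≤x₁) x₁≤b) Px₁ , count-extremes)
        by-extremes (no x₀≰x₁) = inj₁ (ℕP.n≤0⇒n≡0 (ℕP.≤-trans (ℕP.m≤n*m _ c) (ℤP.drop‿+≤+ c*n≤0)))
          where
          c*n≤0 : + (c ℕ.* length S) ≤ 0ℤ
          c*n≤0 = subst (_≤ 0ℤ) (trans (sym count-extremes) (sym (ℤP.pos-* c _)))
                    (ℤP.i≤j⇒i-j≤0 (Φ-mono (≰⇒+1≤ x₀≰x₁)))

-- Φ₂ x = x − ((−x) mod 2) and Φ₃ x = 2x − ((−x) mod 3): Φₚ grows by p exactly at the integers prime to p.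
Φ₂ : ℤ → ℤ
Φ₂ x = x - + 𝟙 (not (2 ∣ᵇ x))

gap₃ : Bool → Bool → ℕ
gap₃ b₀ b₁ = if b₀ then 0 else if b₁ then 1 else 2

Φ₃ : ℤ → ℤ
Φ₃ x = + 2 * x - + gap₃ (3 ∣ᵇ x) (3 ∣ᵇ (x + 1ℤ))

next₃ : ℤ → ℕ
next₃ z = 𝟙 (3 ∣ᵇ (z + 1ℤ))

Φ₂-step : ∀ x → Φ₂ (x + 1ℤ) ≡ Φ₂ x + + 2 * + 𝟙 (coprimeᵇ 2 x)
Φ₂-step x = begin
  x + 1ℤ - + 𝟙 (not (2 ∣ᵇ (x + 1ℤ)))               ≡⟨ cong (λ b → x + 1ℤ - + 𝟙 (not b)) (parity-alternates x) ⟩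
  x + 1ℤ - + 𝟙 (not (not (2 ∣ᵇ x)))                ≡⟨ step (2 ∣ᵇ x) ⟩
  Φ₂ x + + 2 * + 𝟙 (not (2 ∣ᵇ x))                  ≡⟨ cong (λ b → Φ₂ x + + 2 * + 𝟙 b) (coprimeᵇ-prime prime[2] x) ⟨
  Φ₂ x + + 2 * + 𝟙 (coprimeᵇ 2 x)                  ∎
  where
  open ≡-Reasoning
  step : ∀ b → x + 1ℤ - + 𝟙 (not (not b)) ≡ x - + 𝟙 (not b) + + 2 * + 𝟙 (not b)
  step true  = solve (x ∷ [])
  step false = solve (x ∷ [])

Φ₃-step : ∀ x → Φ₃ (x + 1ℤ) ≡ Φ₃ x + + 3 * + 𝟙 (coprimeᵇ 3 x)
Φ₃-step x = trans (step (3 ∣ᵇ x) (3 ∣ᵇ (x + 1ℤ)) (3 ∣ᵇ (x + 1ℤ + 1ℤ)) (one-in-three x))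
                  (cong (λ b → Φ₃ x + + 3 * + 𝟙 b) (sym (coprimeᵇ-prime prime[3] x)))
  where
  step : ∀ b₀ b₁ b₂ → 𝟙 b₀ ℕ.+ 𝟙 b₁ ℕ.+ 𝟙 b₂ ≡ 1 →
    + 2 * (x + 1ℤ) - + gap₃ b₁ b₂ ≡ + 2 * x - + gap₃ b₀ b₁ + + 3 * + 𝟙 (not b₀)
  step true  false false _ = solve (x ∷ [])
  step false true  false _ = solve (x ∷ [])
  step false false true  _ = solve (x ∷ [])

Φ₂-at-odd : ∀ y → 2 ∣ᵇ y ≡ false → Φ₂ y ≡ y - 1ℤ
Φ₂-at-odd _ odd rewrite odd = refl

Φ₂-after-odd : ∀ y → 2 ∣ᵇ y ≡ false → Φ₂ (y + 1ℤ) ≡ y + 1ℤ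
Φ₂-after-odd y odd rewrite parity-alternates y | odd = ℤP.+-identityʳ (y + 1ℤ)

Φ₃-at-coprime : ∀ z → 3 ∣ᵇ z ≡ false → Φ₃ z ≡ + 2 * z - + 2 + + next₃ z
Φ₃-at-coprime z 3∤z rewrite 3∤z = at (3 ∣ᵇ (z + 1ℤ))
  where
  at : ∀ b → + 2 * z - + gap₃ false b ≡ + 2 * z - + 2 + + 𝟙 b
  at true  = solve (z ∷ [])
  at false = solve (z ∷ [])

Φ₃-after-coprime : ∀ z → 3 ∣ᵇ z ≡ false → Φ₃ (z + 1ℤ) ≡ + 2 * z + + 1 + + next₃ z
Φ₃-after-coprime z 3∤z = after (3 ∣ᵇ z) (3 ∣ᵇ (z + 1ℤ)) (3 ∣ᵇ (z + 1ℤ + 1ℤ)) (one-in-three z) 3∤z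
  where
  after : ∀ b₀ b₁ b₂ → 𝟙 b₀ ℕ.+ 𝟙 b₁ ℕ.+ 𝟙 b₂ ≡ 1 → b₀ ≡ false →
    + 2 * (z + 1ℤ) - + gap₃ b₁ b₂ ≡ + 2 * z + + 1 + + 𝟙 b₁
  after false true  false _ _ = solve (z ∷ [])
  after false false true  _ _ = solve (z ∷ [])

next₃-congruent : ∀ {x} y t → x ≡ y + + 3 * t → next₃ x ≡ next₃ y
next₃-congruent y t refl = cong 𝟙 (∣ᵇ-congruent 3 (y + 1ℤ) t (regroup y t))
  where
  regroup : ∀ y t → y + + 3 * t + 1ℤ ≡ y + 1ℤ + + 3 * t
  regroup = solve-∀

multiple₃-around : ∀ z → 3 ∣ᵇ z ≡ false → 𝟙 (3 ∣ᵇ (z - 1ℤ)) ℕ.+ next₃ z ≡ 1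
multiple₃-around z 3∤z = begin
    𝟙 (3 ∣ᵇ (z - 1ℤ)) ℕ.+ next₃ z
  ≡⟨ cong (ℕ._+ next₃ z) (ℕP.+-identityʳ _) ⟨
    𝟙 (3 ∣ᵇ (z - 1ℤ)) ℕ.+ 𝟙 false ℕ.+ next₃ z
  ≡⟨ cong (λ b → 𝟙 (3 ∣ᵇ (z - 1ℤ)) ℕ.+ 𝟙 b ℕ.+ next₃ z) 3∤z ⟨
    𝟙 (3 ∣ᵇ (z - 1ℤ)) ℕ.+ 𝟙 (3 ∣ᵇ z) ℕ.+ 𝟙 (3 ∣ᵇ (z + 1ℤ))
  ≡⟨ cong₂ (λ w w′ → 𝟙 (3 ∣ᵇ (z - 1ℤ)) ℕ.+ 𝟙 (3 ∣ᵇ w) ℕ.+ 𝟙 (3 ∣ᵇ w′)) (i-1+1≡i z) (cong (_+ 1ℤ) (i-1+1≡i z)) ⟨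
    𝟙 (3 ∣ᵇ (z - 1ℤ)) ℕ.+ 𝟙 (3 ∣ᵇ (z - 1ℤ + 1ℤ)) ℕ.+ 𝟙 (3 ∣ᵇ (z - 1ℤ + 1ℤ + 1ℤ))
  ≡⟨ one-in-three (z - 1ℤ) ⟩
    1
  ∎
  where open ≡-Reasoning

-- Rows of M(a,b)

column : ℕ → ℤ → Col
column k j = + k , j

Row : (Col → Set) → (k c : ℕ) → (ℤ → ℤ) → ℕ → Set
Row In k c Φ n = n ≡ 0 ⊎ ∃₂ λ x₀ x₁ → In (+ k , x₀) × In (+ k , x₁) × Coprime k x₀ × Coprime k x₁ ×
                                        + c * + n ≡ Φ (x₁ + 1ℤ) - Φ x₀

row-extremes : ∀ {In : Col → Set} k c Φ .{{_ : NonZero c}} →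
  (∀ x → Φ (x + 1ℤ) ≡ Φ x + + c * + 𝟙 (coprimeᵇ k x)) → (∀ x → ¬ Coprime k x → Coprime k (x + 1ℤ)) →
  ∀ a b → (∀ {col} → col ∈ colsAt k a b → In col) → Row In k c Φ (length (colsAt k a b))
row-extremes {In} k c Φ Φ-step no-gap a b colsAt⊆In =
  subst (Row In k c Φ) (sym length-columns) (in-columns (extremes no-gap a b))
  where
  open Counting (coprime? k) c Φ Φ-step
  S : List ℤ
  S = filter (coprime? k) (intRange a b)
  length-columns : length (colsAt k a b) ≡ length S
  length-columns = LP.length-map (column k) S
  in-columns : length S ≡ 0 ⊎ ∃₂ (λ x₀ x₁ → x₀ ∈ S × x₁ ∈ S × + c * + length S ≡ Φ (x₁ + 1ℤ) - Φ x₀) →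
               Row In k c Φ (length S)
  in-columns (inj₁ empty) = inj₁ empty
  in-columns (inj₂ (x₀ , x₁ , x₀∈S , x₁∈S , count)) =
    inj₂ (x₀ , x₁ , colsAt⊆In (∈-map⁺ (column k) x₀∈S) , colsAt⊆In (∈-map⁺ (column k) x₁∈S) ,
          proj₂ (∈-filter⁻ (coprime? k) {xs = intRange a b} x₀∈S) ,
          proj₂ (∈-filter⁻ (coprime? k) {xs = intRange a b} x₁∈S) , count)

row₁ : ∀ {In : Col → Set} a b → (∀ {col} → col ∈ colsAt 1 a b → In col) → Row In 1 1 (λ x → x) (length (colsAt 1 a b))
row₁ = row-extremes 1 1 (λ x → x) (λ x → cong (λ b → x + + 1 * + 𝟙 b) (sym (coprimeᵇ-1 x)))
                    (λ x ¬coprime → ⊥-elim (¬coprime (gcd-zeroʳ x)))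

row₂ : ∀ {In : Col → Set} a b → (∀ {col} → col ∈ colsAt 2 a b → In col) → Row In 2 2 Φ₂ (length (colsAt 2 a b))
row₂ = row-extremes 2 2 Φ₂ Φ₂-step (coprime-after-multiple prime[2] (λ x 2∣x → trans (parity-alternates x) (cong not 2∣x)))

row₃ : ∀ {In : Col → Set} a b → (∀ {col} → col ∈ colsAt 3 a b → In col) → Row In 3 3 Φ₃ (length (colsAt 3 a b))
row₃ = row-extremes 3 3 Φ₃ Φ₃-step (coprime-after-multiple prime[3] multiple₃-then-not)

row₂-count : ∀ {n} y₀ y₁ → 2 ∣ᵇ y₀ ≡ false → 2 ∣ᵇ y₁ ≡ false →
  + 2 * + n ≡ Φ₂ (y₁ + 1ℤ) - Φ₂ y₀ → + 2 * + n ≡ y₁ - y₀ + + 2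
row₂-count {n} y₀ y₁ y₀-odd y₁-odd count =
  trans count (trans (cong₂ _-_ (Φ₂-after-odd y₁ y₁-odd) (Φ₂-at-odd y₀ y₀-odd)) (regroup y₀ y₁))
  where
  regroup : ∀ y₀ y₁ → y₁ + 1ℤ - (y₀ - 1ℤ) ≡ y₁ - y₀ + + 2
  regroup = solve-∀

row₃-count : ∀ {n} z₀ z₁ → 3 ∣ᵇ z₀ ≡ false → 3 ∣ᵇ z₁ ≡ false → + 3 * + n ≡ Φ₃ (z₁ + 1ℤ) - Φ₃ z₀ →
  + 3 * + n + + next₃ z₀ ≡ + 2 * (z₁ - z₀) + + 3 + + next₃ z₁
row₃-count {n} z₀ z₁ 3∤z₀ 3∤z₁ count = begin
    + 3 * + n + G₀
  ≡⟨ cong (_+ G₀) count ⟩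
    Φ₃ (z₁ + 1ℤ) - Φ₃ z₀ + G₀
  ≡⟨ cong₂ (λ s t → s - t + G₀) (Φ₃-after-coprime z₁ 3∤z₁) (Φ₃-at-coprime z₀ 3∤z₀) ⟩
    + 2 * z₁ + + 1 + G₁ - (+ 2 * z₀ - + 2 + G₀) + G₀
  ≡⟨ regroup z₀ z₁ G₀ G₁ ⟩
    + 2 * (z₁ - z₀) + + 3 + G₁
  ∎
  where
  open ≡-Reasoning
  G₀ : ℤ
  G₀ = + next₃ z₀
  G₁ : ℤ
  G₁ = + next₃ z₁
  regroup : ∀ z₀ z₁ G₀ G₁ → + 2 * z₁ + + 1 + G₁ - (+ 2 * z₀ - + 2 + G₀) + G₀ ≡ + 2 * (z₁ - z₀) + + 3 + G₁
  regroup = solve-∀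

-- The bound Δ + β (Δ mod 6)

-- β r is the excess of the bound over Δ when Δ ≡ r (mod 6).
β : ℕ → ℕ
β 0 = 2
β 1 = 3
β 2 = 4
β 3 = 3
β 4 = 2
β 5 = 3
β _ = 0

columnBound : ℕ → ℕ
columnBound Δ = Δ ℕ.+ β (Δ ℕ.% 6)

Δ+2≤columnBound : ∀ Δ → Δ ℕ.+ 2 ℕ.≤ columnBound Δ
Δ+2≤columnBound Δ = ℕP.+-monoʳ-≤ Δ (all-residues (λ r → 2 ℕ.≤? β r) (m%n<n Δ 6))

1≤columnBound : ∀ Δ → 1 ℕ.≤ columnBound Δ
1≤columnBound Δ = ℕP.≤-trans (ℕP.≤-trans (s≤s z≤n) (ℕP.m≤n+m 2 Δ)) (Δ+2≤columnBound Δ)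

Δ+3≤columnBound-or-even : ∀ Δ → Δ ℕ.+ 3 ℕ.≤ columnBound Δ ⊎ 2 ∣ᵇ + Δ ≡ true
Δ+3≤columnBound-or-even Δ
  with all-residues (λ r → (3 ℕ.≤? β r) ⊎-dec (2 ∣ᵇ + r ≟ᵇ true)) (m%n<n Δ 6)
... | inj₁ 3≤β = inj₁ (ℕP.+-monoʳ-≤ Δ 3≤β)
... | inj₂ even = inj₂ (trans (∣ᵇ-residue 2∣6 (ℕ-residue 6 Δ)) even)

-- The residue of Δ − u modulo 6, from the residues δ of Δ and r of u.
residue-of-difference : ℕ → ℕ → ℕ
residue-of-difference δ r = (δ ℕ.+ (6 ℕ.∸ r)) ℕ.% 6

difference-residue-≤ : ∀ Δ {u r} → u ≤ + Δ → u ≡ r [mod 6 ] → r ℕ.< 6 → + residue-of-difference (Δ ℕ.% 6) r ≤ + Δ - u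
difference-residue-≤ Δ {r = r} u≤Δ u≡r r<6 =
  least-residue (mod-% (mod-∸ (ℕ-residue 6 Δ) u≡r (ℕP.<⇒≤ r<6))) (m%n<n (Δ ℕ.% 6 ℕ.+ (6 ℕ.∸ r)) 6) (ℤP.i≤j⇒0≤j-i u≤Δ)

MixedMinorTable : ℕ → ℕ → ℕ → Set
MixedMinorTable δ r s = 3 ∣ᵇ + r ≡ false → 3 ∣ᵇ + (r ℕ.+ s) ≡ true → 2 ∣ᵇ + s ≡ false →
  + 11 + + 2 * + 𝟙 (3 ∣ᵇ + suc r) ≤ + 3 * + β δ + + 2 * + residue-of-difference δ r + + residue-of-difference δ s

mixed-minor-table : ∀ {δ r s} → δ ℕ.< 6 → r ℕ.< 6 → s ℕ.< 6 → MixedMinorTable δ r s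
mixed-minor-table δ<6 r<6 s<6 = all-residues (λ δ → ℕP.allUpTo? (λ r → ℕP.allUpTo? (λ s → table? δ r s) 6) 6) δ<6 r<6 s<6
  where
  table? : ∀ δ r s → Dec (MixedMinorTable δ r s)
  table? δ r s = (3 ∣ᵇ + r ≟ᵇ false) →-dec ((3 ∣ᵇ + (r ℕ.+ s) ≟ᵇ true) →-dec ((2 ∣ᵇ + s ≟ᵇ false) →-dec (_ ℤ.≤? _)))

mixed-minors-bound : ∀ Δ {u v} → u ≤ + Δ → v ≤ + Δ → 3 ∣ᵇ u ≡ false → 3 ∣ᵇ (u + v) ≡ true → 2 ∣ᵇ v ≡ false →
  + 2 * u + v + + 2 * + next₃ u + + 11 ≤ + 3 * + columnBound Δ
mixed-minors-bound Δ {u} {v} u≤Δ v≤Δ 3∤u 3∣u+v 2∤v with residue 6 u | residue 6 v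
... | r , r<6 , u≡r | s , s<6 , v≡s =
  ≤-by-natural _ (natural-+ (natural-+ (natural-* 2 (natural-≤ σ≤Δ-u)) (natural-≤ τ≤Δ-v)) (natural-≤ table))
    (trans (cong (λ G → + 3 * (+ Δ + + β δ) - (+ 2 * u + v + + 2 * + G + + 11)) next₃u≡)
           (certificate (+ Δ) u v (+ β δ) (+ σ) (+ τ) (+ 𝟙 (3 ∣ᵇ + suc r))))
  where
  δ : ℕ
  δ = Δ ℕ.% 6
  σ : ℕ
  σ = residue-of-difference δ r
  τ : ℕ
  τ = residue-of-difference δ s
  σ≤Δ-u : + σ ≤ + Δ - u
  σ≤Δ-u = difference-residue-≤ Δ u≤Δ u≡r r<6
  τ≤Δ-v : + τ ≤ + Δ - v
  τ≤Δ-v = difference-residue-≤ Δ v≤Δ v≡s s<6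
  table : + 11 + + 2 * + 𝟙 (3 ∣ᵇ + suc r) ≤ + 3 * + β δ + + 2 * + σ + + τ
  table = mixed-minor-table (m%n<n Δ 6) r<6 s<6
    (trans (sym (∣ᵇ-residue 3∣6 u≡r)) 3∤u)
    (trans (sym (∣ᵇ-residue 3∣6 (mod-+ u≡r v≡s))) 3∣u+v)
    (trans (sym (∣ᵇ-residue 2∣6 v≡s)) 2∤v)
  next₃u≡ : next₃ u ≡ 𝟙 (3 ∣ᵇ + suc r)
  next₃u≡ = cong 𝟙 (trans (∣ᵇ-residue 3∣6 (mod-+ℕ 1 u≡r)) (cong (λ t → 3 ∣ᵇ + t) (ℕP.+-comm r 1)))
  certificate : ∀ D u v B σ τ G → + 3 * (D + B) - (+ 2 * u + v + + 2 * G + + 11) ≡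
    + 2 * (D - u - σ) + (D - v - τ) + ((+ 3 * B + + 2 * σ + τ) - (+ 11 + + 2 * G))
  certificate = solve-∀

natural-1-𝟙 : ∀ b → Natural (1ℤ - + 𝟙 b)
natural-1-𝟙 true  = 0 , refl
natural-1-𝟙 false = 1 , refl

odd-below-even : ∀ {u D} → 2 ∣ᵇ u ≡ false → 2 ∣ᵇ D ≡ true → u ≤ D → u ≤ D - 1ℤ
odd-below-even {u} {D} u-odd D-even u≤D =
  subst (_≤ D - 1ℤ) (cancel u) (ℤP.+-monoˡ-≤ (- 1ℤ) (≰⇒+1≤ (λ D≤u → u≢D (ℤP.≤-antisym u≤D D≤u))))
  where
  u≢D : u ≢ D
  u≢D refl with trans (sym u-odd) D-even
  ... | ()
  cancel : ∀ u → u + 1ℤ - 1ℤ ≡ u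
  cancel = solve-∀

row₃-spread : ∀ {D} z₀ z₁ → + 3 ≤ D → + 3 * z₁ - + 3 * z₀ ≤ D → z₁ - z₀ + + 2 ≤ D
row₃-spread {D} z₀ z₁ 3≤D 3[z₁-z₀]≤D with z₁ ℤ.≤? z₀
... | yes z₁≤z₀ = ≤-by-natural _ (natural-+ (natural-+ (natural-≤ 3≤D) (natural-≤ z₁≤z₀)) (1 , refl))
  (certificate D z₀ z₁)
  where
  certificate : ∀ D z₀ z₁ → D - (z₁ - z₀ + + 2) ≡ D - + 3 + (z₀ - z₁) + 1ℤ
  certificate = solve-∀
... | no z₁≰z₀ = ≤-by-natural _ (natural-+ (natural-≤ 3[z₁-z₀]≤D) (natural-* 2 (natural-≤ (≰⇒+1≤ z₁≰z₀))))
  (certificate D z₀ z₁)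
  where
  certificate : ∀ D z₀ z₁ → D - (z₁ - z₀ + + 2) ≡ D - (+ 3 * z₁ - + 3 * z₀) + + 2 * (z₁ - (z₀ + 1ℤ))
  certificate = solve-∀

bound-rows-1 : ∀ {D N₁} p q → + 1 * N₁ ≡ q + 1ℤ - p → + 1 * q - + 1 * p ≤ D → 1ℤ + N₁ + 0ℤ + 0ℤ ≤ D + + 2
bound-rows-1 {D} {N₁} p q count₁ minor =
  ≤-by-certificate _ _ (natural-≤ minor) (cong -_ (ℤP.i≡j⇒i-j≡0 count₁)) (certificate D N₁ p q)
  where
  certificate : ∀ D N₁ p q → D + + 2 - (1ℤ + N₁ + 0ℤ + 0ℤ) ≡ (D - (+ 1 * q - + 1 * p)) + - (+ 1 * N₁ - (q + 1ℤ - p))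
  certificate = solve-∀

bound-rows-2 : ∀ {D N₂} y₀ y₁ → Natural D → + 2 * N₂ ≡ y₁ - y₀ + + 2 → + 2 * y₁ - + 2 * y₀ ≤ D →
  + 4 * (1ℤ + 0ℤ + N₂ + 0ℤ) ≤ + 4 * (D + + 2) + + 3
bound-rows-2 {D} {N₂} y₀ y₁ D≥0 count₂ minor =
  ≤-by-certificate _ _ (natural-+ (natural-+ (natural-≤ minor) (natural-* 3 D≥0)) (3 , refl))
    (cong (λ t → - (+ 2 * t)) (ℤP.i≡j⇒i-j≡0 count₂)) (certificate D N₂ y₀ y₁)
  where
  certificate : ∀ D N₂ y₀ y₁ → + 4 * (D + + 2) + + 3 - + 4 * (1ℤ + 0ℤ + N₂ + 0ℤ) ≡
    (D - (+ 2 * y₁ - + 2 * y₀) + + 3 * D + + 3) + - (+ 2 * (+ 2 * N₂ - (y₁ - y₀ + + 2)))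
  certificate = solve-∀

bound-rows-3 : ∀ {D N₃ G₀ G₁} z₀ z₁ → Natural D → Natural G₀ → Natural (1ℤ - G₁) →
  + 3 * N₃ + G₀ ≡ + 2 * (z₁ - z₀) + + 3 + G₁ → z₁ - z₀ + + 2 ≤ D → + 3 * (1ℤ + 0ℤ + 0ℤ + N₃) ≤ + 3 * (D + + 2) + + 2
bound-rows-3 {D} {N₃} {G₀} {G₁} z₀ z₁ D≥0 G₀≥0 G₁≤1 count₃ spread =
  ≤-by-certificate _ _
    (natural-+ (natural-+ (natural-+ (natural-+ (natural-* 2 (natural-≤ spread)) D≥0) G₁≤1) (5 , refl)) G₀≥0)
    (cong -_ (ℤP.i≡j⇒i-j≡0 count₃)) (certificate D N₃ z₀ z₁ G₀ G₁)
  where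
  certificate : ∀ D N₃ z₀ z₁ G₀ G₁ → + 3 * (D + + 2) + + 2 - + 3 * (1ℤ + 0ℤ + 0ℤ + N₃) ≡
    (+ 2 * (D - (z₁ - z₀ + + 2)) + D + (1ℤ - G₁) + + 5 + G₀) + - (+ 3 * N₃ + G₀ - (+ 2 * (z₁ - z₀) + + 3 + G₁))
  certificate = solve-∀

bound-rows-12 : ∀ {D N₁ N₂} p q y₀ y₁ → + 1 * N₁ ≡ q + 1ℤ - p → + 2 * N₂ ≡ y₁ - y₀ + + 2 →
  + 1 * y₁ - + 2 * p ≤ D → + 2 * q - + 1 * y₀ ≤ D → + 2 * (1ℤ + N₁ + N₂ + 0ℤ) ≤ + 2 * (D + + 3) + + 1
bound-rows-12 {D} {N₁} {N₂} p q y₀ y₁ count₁ count₂ minor₁ minor₂ =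
  ≤-by-certificate _ _ (natural-+ (natural-+ (natural-≤ minor₁) (natural-≤ minor₂)) (1 , refl))
    (cong₂ (λ s t → - (+ 2 * s) - t) (ℤP.i≡j⇒i-j≡0 count₁) (ℤP.i≡j⇒i-j≡0 count₂)) (certificate D N₁ N₂ p q y₀ y₁)
  where
  certificate : ∀ D N₁ N₂ p q y₀ y₁ → + 2 * (D + + 3) + + 1 - + 2 * (1ℤ + N₁ + N₂ + 0ℤ) ≡
    (D - (+ 1 * y₁ - + 2 * p) + (D - (+ 2 * q - + 1 * y₀)) + 1ℤ) +
    (- (+ 2 * (+ 1 * N₁ - (q + 1ℤ - p))) - (+ 2 * N₂ - (y₁ - y₀ + + 2)))
  certificate = solve-∀

bound-rows-13 : ∀ {D N₁ N₃ G₀ G₁} p q z₀ z₁ → Natural G₀ → Natural (1ℤ - G₁) →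
  + 1 * N₁ ≡ q + 1ℤ - p → + 3 * N₃ + G₀ ≡ + 2 * (z₁ - z₀) + + 3 + G₁ → z₁ - z₀ + + 2 ≤ D →
  + 1 * z₁ - + 3 * p ≤ D → + 3 * q - + 1 * z₀ ≤ D → + 3 * (1ℤ + N₁ + 0ℤ + N₃) ≤ + 3 * (D + + 2) + + 2
bound-rows-13 {D} {N₁} {N₃} {G₀} {G₁} p q z₀ z₁ G₀≥0 G₁≤1 count₁ count₃ spread minor₁ minor₂ =
  ≤-by-certificate _ _
    (natural-+ (natural-+ (natural-+ (natural-+ (natural-≤ minor₁) (natural-≤ minor₂)) (natural-≤ spread)) G₁≤1) G₀≥0)
    (cong₂ (λ s t → - (+ 3 * s) - t) (ℤP.i≡j⇒i-j≡0 count₁) (ℤP.i≡j⇒i-j≡0 count₃))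
    (certificate D N₁ N₃ p q z₀ z₁ G₀ G₁)
  where
  certificate : ∀ D N₁ N₃ p q z₀ z₁ G₀ G₁ → + 3 * (D + + 2) + + 2 - + 3 * (1ℤ + N₁ + 0ℤ + N₃) ≡
    (D - (+ 1 * z₁ - + 3 * p) + (D - (+ 3 * q - + 1 * z₀)) + (D - (z₁ - z₀ + + 2)) + (1ℤ - G₁) + G₀) +
    (- (+ 3 * (+ 1 * N₁ - (q + 1ℤ - p))) - (+ 3 * N₃ + G₀ - (+ 2 * (z₁ - z₀) + + 3 + G₁)))
  certificate = solve-∀

bound-rows-23 : ∀ {D N₂ N₃ G₀ G₁} y₀ y₁ z₀ z₁ → Natural D → Natural G₀ → Natural (1ℤ - G₁) →
  + 2 * N₂ ≡ y₁ - y₀ + + 2 → + 3 * N₃ + G₀ ≡ + 2 * (z₁ - z₀) + + 3 + G₁ → z₁ - z₀ + + 2 ≤ D →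
  + 2 * z₁ - + 3 * y₀ ≤ D → + 3 * y₁ - + 2 * z₀ ≤ D → + 6 * (1ℤ + 0ℤ + N₂ + N₃) ≤ + 6 * (D + + 2) + + 5
bound-rows-23 {D} {N₂} {N₃} {G₀} {G₁} y₀ y₁ z₀ z₁ D≥0 G₀≥0 G₁≤1 count₂ count₃ spread minor₁ minor₂ =
  ≤-by-certificate _ _
    (natural-+ (natural-+ (natural-+ (natural-+ (natural-+ (natural-+ (natural-≤ minor₁) (natural-≤ minor₂))
      (natural-* 2 (natural-≤ spread))) (natural-* 2 D≥0)) (natural-* 2 G₁≤1)) (1 , refl)) (natural-* 2 G₀≥0))
    (cong₂ (λ s t → - (+ 3 * s) - + 2 * t) (ℤP.i≡j⇒i-j≡0 count₂) (ℤP.i≡j⇒i-j≡0 count₃))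
    (certificate D N₂ N₃ y₀ y₁ z₀ z₁ G₀ G₁)
  where
  certificate : ∀ D N₂ N₃ y₀ y₁ z₀ z₁ G₀ G₁ → + 6 * (D + + 2) + + 5 - + 6 * (1ℤ + 0ℤ + N₂ + N₃) ≡
    (D - (+ 2 * z₁ - + 3 * y₀) + (D - (+ 3 * y₁ - + 2 * z₀)) + + 2 * (D - (z₁ - z₀ + + 2)) + + 2 * D +
      + 2 * (1ℤ - G₁) + 1ℤ + + 2 * G₀) +
    (- (+ 3 * (+ 2 * N₂ - (y₁ - y₀ + + 2))) - + 2 * (+ 3 * N₃ + G₀ - (+ 2 * (z₁ - z₀) + + 3 + G₁)))
  certificate = solve-∀

bound-rows-123 : ∀ {B N₁ N₂ N₃ G₀ G₁ H} p q y₀ y₁ z₀ z₁ →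
  + 1 * N₁ ≡ q + 1ℤ - p → + 2 * N₂ ≡ y₁ - y₀ + + 2 → + 3 * N₃ + G₀ ≡ + 2 * (z₁ - z₀) + + 3 + G₁ → H + G₀ ≡ 1ℤ →
  + 2 * (+ 1 * z₁ - + 3 * p) + (+ 2 * z₁ - + 3 * y₀) + + 2 * G₁ + + 11 ≤ + 3 * B →
  + 2 * (+ 3 * q - + 1 * z₀) + (+ 3 * y₁ - + 2 * z₀) + + 2 * H + + 11 ≤ + 3 * B →
  + 6 * (1ℤ + N₁ + N₂ + N₃) ≤ + 6 * B + + 5
bound-rows-123 {B} {N₁} {N₂} {N₃} {G₀} {G₁} {H} p q y₀ y₁ z₀ z₁
  count₁ count₂ count₃ H+G₀≡1 mixed₁ mixed₂ =
  ≤-by-certificate _ _ (natural-+ (natural-+ (natural-≤ mixed₁) (natural-≤ mixed₂)) (5 , refl))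
    (cong₂ _+_ (cong₂ (λ s t → - (+ 6 * s) - + 3 * t) (ℤP.i≡j⇒i-j≡0 count₁) (ℤP.i≡j⇒i-j≡0 count₂))
               (cong₂ (λ s t → - (+ 2 * s) + + 2 * t) (ℤP.i≡j⇒i-j≡0 count₃) (ℤP.i≡j⇒i-j≡0 H+G₀≡1)))
    (certificate B N₁ N₂ N₃ p q y₀ y₁ z₀ z₁ G₀ G₁ H)
  where
  certificate : ∀ B N₁ N₂ N₃ p q y₀ y₁ z₀ z₁ G₀ G₁ H → + 6 * B + + 5 - + 6 * (1ℤ + N₁ + N₂ + N₃) ≡
    (+ 3 * B - (+ 2 * (+ 1 * z₁ - + 3 * p) + (+ 2 * z₁ - + 3 * y₀) + + 2 * G₁ + + 11) +
     (+ 3 * B - (+ 2 * (+ 3 * q - + 1 * z₀) + (+ 3 * y₁ - + 2 * z₀) + + 2 * H + + 11)) + + 5) +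
    ((- (+ 6 * (+ 1 * N₁ - (q + 1ℤ - p))) - + 3 * (+ 2 * N₂ - (y₁ - y₀ + + 2))) +
     (- (+ 2 * (+ 3 * N₃ + G₀ - (+ 2 * (z₁ - z₀) + + 3 + G₁))) + + 2 * (H + G₀ - 1ℤ)))
  certificate = solve-∀

module ColumnBound (Δ : ℕ) (In : Col → Set) (minor : ∀ {c c′} → In c → In c′ → det c c′ ≤ + Δ)
                   (origin : In (+ 0 , + 1)) where

  columns-bound-12 : ∀ {n₁ n₂} p q y₀ y₁ → In (+ 1 , p) → In (+ 1 , q) → In (+ 2 , y₀) → In (+ 2 , y₁) →
    2 ∣ᵇ y₀ ≡ false → 2 ∣ᵇ y₁ ≡ false → + 1 * + n₁ ≡ q + 1ℤ - p → + 2 * + n₂ ≡ y₁ - y₀ + + 2 →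
    suc (n₁ ℕ.+ n₂ ℕ.+ 0) ℕ.≤ columnBound Δ
  columns-bound-12 {n₁} {n₂} p q y₀ y₁ ∈p ∈q ∈y₀ ∈y₁ y₀-odd y₁-odd count₁ count₂
    with Δ+3≤columnBound-or-even Δ
  ... | inj₁ Δ+3≤bound =
    ℕP.≤-trans (≤-by-scaling 1 (bound-rows-12 p q y₀ y₁ count₁ count₂ (minor ∈p ∈y₁) (minor ∈y₀ ∈q))) Δ+3≤bound
  ... | inj₂ Δ-even =
    ℕP.≤-trans (≤-by-scaling 1 (subst (λ t → + 2 * (1ℤ + + n₁ + + n₂ + 0ℤ) ≤ + 2 * t + + 1) (shift (+ Δ))
                 (bound-rows-12 p q y₀ y₁ count₁ count₂ (odd-below-even minor₁-odd Δ-even (minor ∈p ∈y₁))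
                                                        (odd-below-even minor₂-odd Δ-even (minor ∈y₀ ∈q)))))
               (Δ+2≤columnBound Δ)
    where
    regroup₁ : ∀ y₁ p → + 1 * y₁ - + 2 * p ≡ y₁ + + 2 * (- p)
    regroup₁ = solve-∀
    regroup₂ : ∀ y₀ q → + 2 * q - + 1 * y₀ ≡ - y₀ + + 2 * q
    regroup₂ = solve-∀
    -- Δ is even and both mixed minors are odd, so they are at most Δ − 1.
    minor₁-odd : 2 ∣ᵇ (+ 1 * y₁ - + 2 * p) ≡ false
    minor₁-odd = trans (∣ᵇ-congruent 2 y₁ (- p) (regroup₁ y₁ p)) y₁-odd
    minor₂-odd : 2 ∣ᵇ (+ 2 * q - + 1 * y₀) ≡ false
    minor₂-odd = trans (∣ᵇ-congruent 2 (- y₀) q (regroup₂ y₀ q)) (trans (∣ᵇ-neg 2 y₀) y₀-odd)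
    shift : ∀ D → D - 1ℤ + + 3 ≡ D + + 2
    shift = solve-∀

  columns-bound-123 : ∀ {n₁ n₂ n₃} p q y₀ y₁ z₀ z₁ →
    In (+ 1 , p) → In (+ 1 , q) → In (+ 2 , y₀) → In (+ 2 , y₁) → In (+ 3 , z₀) → In (+ 3 , z₁) →
    2 ∣ᵇ y₀ ≡ false → 2 ∣ᵇ y₁ ≡ false → 3 ∣ᵇ z₀ ≡ false → 3 ∣ᵇ z₁ ≡ false →
    + 1 * + n₁ ≡ q + 1ℤ - p → + 2 * + n₂ ≡ y₁ - y₀ + + 2 →
    + 3 * + n₃ + + next₃ z₀ ≡ + 2 * (z₁ - z₀) + + 3 + + next₃ z₁ →
    suc (n₁ ℕ.+ n₂ ℕ.+ n₃) ℕ.≤ columnBound Δ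
  columns-bound-123 {n₁} {n₂} {n₃} p q y₀ y₁ z₀ z₁ ∈p ∈q ∈y₀ ∈y₁ ∈z₀ ∈z₁ y₀-odd y₁-odd 3∤z₀ 3∤z₁
                    count₁ count₂ count₃ =
    ≤-by-scaling 5 (bound-rows-123 {+ columnBound Δ} {+ n₁} {+ n₂} {+ n₃} {+ next₃ z₀} {+ next₃ z₁} {+ next₃ u₂}
                      p q y₀ y₁ z₀ z₁ count₁ count₂ count₃ next₃u₂+next₃z₀≡1 mixed₁ mixed₂)
    where
    u₂ : ℤ
    u₂ = + 3 * q - + 1 * z₀
    regroup-u₁ : ∀ z₁ p → + 1 * z₁ - + 3 * p ≡ z₁ + + 3 * (- p)
    regroup-u₁ = solve-∀
    regroup-u₁+v₁ : ∀ z₁ p y₀ → + 1 * z₁ - + 3 * p + (+ 2 * z₁ - + 3 * y₀) ≡ + 3 * (z₁ - p - y₀)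
    regroup-u₁+v₁ = solve-∀
    regroup-v₁ : ∀ z₁ y₀ → + 2 * z₁ - + 3 * y₀ ≡ y₀ + + 2 * (z₁ - + 2 * y₀)
    regroup-v₁ = solve-∀
    regroup-u₂ : ∀ q z₀ → + 3 * q - + 1 * z₀ ≡ - z₀ + + 3 * q
    regroup-u₂ = solve-∀
    regroup-u₂+1 : ∀ q z₀ → + 3 * q - + 1 * z₀ + 1ℤ ≡ - (z₀ - 1ℤ) + + 3 * q
    regroup-u₂+1 = solve-∀
    regroup-u₂+v₂ : ∀ q z₀ y₁ → + 3 * q - + 1 * z₀ + (+ 3 * y₁ - + 2 * z₀) ≡ + 3 * (q + y₁ - z₀)
    regroup-u₂+v₂ = solve-∀
    regroup-v₂ : ∀ y₁ z₀ → + 3 * y₁ - + 2 * z₀ ≡ y₁ + + 2 * (y₁ - z₀)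
    regroup-v₂ = solve-∀
    mixed₁ : + 2 * (+ 1 * z₁ - + 3 * p) + (+ 2 * z₁ - + 3 * y₀) + + 2 * + next₃ z₁ + + 11 ≤ + 3 * + columnBound Δ
    mixed₁ = subst (λ G → + 2 * (+ 1 * z₁ - + 3 * p) + (+ 2 * z₁ - + 3 * y₀) + + 2 * + G + + 11 ≤ + 3 * + columnBound Δ)
      (next₃-congruent z₁ (- p) (regroup-u₁ z₁ p))
      (mixed-minors-bound Δ (minor ∈p ∈z₁) (minor ∈y₀ ∈z₁)
        (trans (∣ᵇ-congruent 3 z₁ (- p) (regroup-u₁ z₁ p)) 3∤z₁)
        (trans (cong (3 ∣ᵇ_) (regroup-u₁+v₁ z₁ p y₀)) (∣ᵇ-multiple 3 (z₁ - p - y₀)))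
        (trans (∣ᵇ-congruent 2 y₀ (z₁ - + 2 * y₀) (regroup-v₁ z₁ y₀)) y₀-odd))
    mixed₂ : + 2 * (+ 3 * q - + 1 * z₀) + (+ 3 * y₁ - + 2 * z₀) + + 2 * + next₃ u₂ + + 11
             ≤ + 3 * + columnBound Δ
    mixed₂ = mixed-minors-bound Δ (minor ∈z₀ ∈q) (minor ∈z₀ ∈y₁)
      (trans (∣ᵇ-congruent 3 (- z₀) q (regroup-u₂ q z₀)) (trans (∣ᵇ-neg 3 z₀) 3∤z₀))
      (trans (cong (3 ∣ᵇ_) (regroup-u₂+v₂ q z₀ y₁)) (∣ᵇ-multiple 3 (q + y₁ - z₀)))
      (trans (∣ᵇ-congruent 2 y₁ (y₁ - z₀) (regroup-v₂ y₁ z₀)) y₁-odd)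
    next₃u₂+next₃z₀≡1 : + next₃ u₂ + + next₃ z₀ ≡ 1ℤ
    next₃u₂+next₃z₀≡1 = cong +_ (trans (cong (λ G → 𝟙 G ℕ.+ next₃ z₀)
                                      (trans (∣ᵇ-congruent 3 (- (z₀ - 1ℤ)) q (regroup-u₂+1 q z₀)) (∣ᵇ-neg 3 (z₀ - 1ℤ))))
                                    (multiple₃-around z₀ 3∤z₀))

  Row₂ : ℕ → Set
  Row₂ n = n ≡ 0 ⊎ ∃₂ λ y₀ y₁ → In (+ 2 , y₀) × In (+ 2 , y₁) × 2 ∣ᵇ y₀ ≡ false × 2 ∣ᵇ y₁ ≡ false ×
                                 + 2 * + n ≡ y₁ - y₀ + + 2

  Row₃ : ℕ → Set
  Row₃ n = n ≡ 0 ⊎ ∃₂ λ z₀ z₁ → In (+ 3 , z₀) × In (+ 3 , z₁) × 3 ∣ᵇ z₀ ≡ false × 3 ∣ᵇ z₁ ≡ false ×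
                                 z₁ - z₀ + + 2 ≤ + Δ × + 3 * + n + + next₃ z₀ ≡ + 2 * (z₁ - z₀) + + 3 + + next₃ z₁

  row₂-view : ∀ {n} → Row In 2 2 Φ₂ n → Row₂ n
  row₂-view (inj₁ empty) = inj₁ empty
  row₂-view {n} (inj₂ (y₀ , y₁ , ∈y₀ , ∈y₁ , c₀ , c₁ , count)) =
    inj₂ (y₀ , y₁ , ∈y₀ , ∈y₁ , y₀-odd , y₁-odd , row₂-count {n} y₀ y₁ y₀-odd y₁-odd count)
    where
    y₀-odd : 2 ∣ᵇ y₀ ≡ false
    y₀-odd = coprime⇒∤ y₀ prime[2] c₀
    y₁-odd : 2 ∣ᵇ y₁ ≡ false
    y₁-odd = coprime⇒∤ y₁ prime[2] c₁

  row₃-view : ∀ {n} → Row In 3 3 Φ₃ n → Row₃ n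
  row₃-view (inj₁ empty) = inj₁ empty
  row₃-view {n} (inj₂ (z₀ , z₁ , ∈z₀ , ∈z₁ , c₀ , c₁ , count)) =
    inj₂ (z₀ , z₁ , ∈z₀ , ∈z₁ , 3∤z₀ , 3∤z₁ , row₃-spread z₀ z₁ (minor ∈z₀ origin) (minor ∈z₀ ∈z₁) ,
          row₃-count {n} z₀ z₁ 3∤z₀ 3∤z₁ count)
    where
    3∤z₀ : 3 ∣ᵇ z₀ ≡ false
    3∤z₀ = coprime⇒∤ z₀ prime[3] c₀
    3∤z₁ : 3 ∣ᵇ z₁ ≡ false
    3∤z₁ = coprime⇒∤ z₁ prime[3] c₁

  columns-bound′ : ∀ {n₁ n₂ n₃} → Row In 1 1 (λ x → x) n₁ → Row₂ n₂ → Row₃ n₃ →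
    suc (n₁ ℕ.+ n₂ ℕ.+ n₃) ℕ.≤ columnBound Δ
  columns-bound′ (inj₁ refl) (inj₁ refl) (inj₁ refl) = 1≤columnBound Δ
  columns-bound′ {n₁} (inj₂ (p , q , ∈p , ∈q , _ , _ , count₁)) (inj₁ refl) (inj₁ refl) =
    ℕP.≤-trans (ℤP.drop‿+≤+ (bound-rows-1 {N₁ = + n₁} p q count₁ (minor ∈p ∈q))) (Δ+2≤columnBound Δ)
  columns-bound′ {n₂ = n₂} (inj₁ refl) (inj₂ (y₀ , y₁ , ∈y₀ , ∈y₁ , _ , _ , count₂)) (inj₁ refl) =
    ℕP.≤-trans (≤-by-scaling 3 (bound-rows-2 {N₂ = + n₂} y₀ y₁ (Δ , refl) count₂ (minor ∈y₀ ∈y₁)))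
               (Δ+2≤columnBound Δ)
  columns-bound′ {n₃ = n₃} (inj₁ refl) (inj₁ refl) (inj₂ (z₀ , z₁ , _ , _ , _ , _ , spread , count₃)) =
    ℕP.≤-trans (≤-by-scaling 2 (bound-rows-3 {N₃ = + n₃} z₀ z₁ (Δ , refl) (next₃ z₀ , refl)
                                  (natural-1-𝟙 (3 ∣ᵇ (z₁ + 1ℤ))) count₃ spread))
               (Δ+2≤columnBound Δ)
  columns-bound′ {n₁} {n₂} (inj₂ (p , q , ∈p , ∈q , _ , _ , count₁))
    (inj₂ (y₀ , y₁ , ∈y₀ , ∈y₁ , y₀-odd , y₁-odd , count₂)) (inj₁ refl) =
    columns-bound-12 {n₁} {n₂} p q y₀ y₁ ∈p ∈q ∈y₀ ∈y₁ y₀-odd y₁-odd count₁ count₂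
  columns-bound′ {n₁} {n₃ = n₃} (inj₂ (p , q , ∈p , ∈q , _ , _ , count₁)) (inj₁ refl)
    (inj₂ (z₀ , z₁ , ∈z₀ , ∈z₁ , _ , _ , spread , count₃)) =
    ℕP.≤-trans (≤-by-scaling 2 (bound-rows-13 {N₁ = + n₁} {N₃ = + n₃} p q z₀ z₁ (next₃ z₀ , refl)
                                  (natural-1-𝟙 (3 ∣ᵇ (z₁ + 1ℤ))) count₁ count₃ spread (minor ∈p ∈z₁) (minor ∈z₀ ∈q)))
               (Δ+2≤columnBound Δ)
  columns-bound′ {n₂ = n₂} {n₃} (inj₁ refl) (inj₂ (y₀ , y₁ , ∈y₀ , ∈y₁ , _ , _ , count₂))
    (inj₂ (z₀ , z₁ , ∈z₀ , ∈z₁ , _ , _ , spread , count₃)) =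
    ℕP.≤-trans (≤-by-scaling 5 (bound-rows-23 {N₂ = + n₂} {N₃ = + n₃} y₀ y₁ z₀ z₁ (Δ , refl) (next₃ z₀ , refl)
                                  (natural-1-𝟙 (3 ∣ᵇ (z₁ + 1ℤ))) count₂ count₃ spread (minor ∈y₀ ∈z₁) (minor ∈z₀ ∈y₁)))
               (Δ+2≤columnBound Δ)
  columns-bound′ (inj₂ (p , q , ∈p , ∈q , _ , _ , count₁)) (inj₂ (y₀ , y₁ , ∈y₀ , ∈y₁ , y₀-odd , y₁-odd , count₂))
                 (inj₂ (z₀ , z₁ , ∈z₀ , ∈z₁ , 3∤z₀ , 3∤z₁ , _ , count₃)) =
    columns-bound-123 p q y₀ y₁ z₀ z₁ ∈p ∈q ∈y₀ ∈y₁ ∈z₀ ∈z₁ y₀-odd y₁-odd 3∤z₀ 3∤z₁ count₁ count₂ count₃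

  columns-bound : ∀ {n₁ n₂ n₃} → Row In 1 1 (λ x → x) n₁ → Row In 2 2 Φ₂ n₂ → Row In 3 3 Φ₃ n₃ →
    suc (n₁ ℕ.+ n₂ ℕ.+ n₃) ℕ.≤ columnBound Δ
  columns-bound r₁ r₂ r₃ = columns-bound′ r₁ (row₂-view r₂) (row₃-view r₃)

minor-bound : ∀ {Δ A} → Submodular Δ A → ∀ {c c′} → c ∈ A → c′ ∈ A → det c c′ ≤ + Δ
minor-bound {Δ} (_ , bounded) c∈A c′∈A =
  subst₂ (λ c c′ → det c c′ ≤ + Δ) (sym (lookup-index c∈A)) (sym (lookup-index c′∈A))
    (ℤP.≤-trans (i≤+∣i∣ _) (+≤+ (bounded (index c∈A) (index c′∈A))))

columns≤columnBound : ∀ Δ m → m ℕ.≤ 3 → ∀ a b → Submodular Δ (M m a b) → ncols (M m a b) ℕ.≤ columnBound Δ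
columns≤columnBound Δ zero _ a b _ = 1≤columnBound Δ
columns≤columnBound Δ 1 _ a b submodular =
  subst (ℕ._≤ columnBound Δ) (cong suc (trans (ℕP.+-identityʳ (length C₁ ℕ.+ 0)) (ℕP.+-identityʳ (length C₁))))
    (columns-bound (row₁ (a fzero) (b fzero) C₁⊆M) (inj₁ refl) (inj₁ refl))
  where
  open ColumnBound Δ (_∈ M 1 a b) (minor-bound submodular) (here refl)
  C₁ : List Col
  C₁ = colsAt 1 (a fzero) (b fzero)
  C₁⊆M : ∀ {col} → col ∈ C₁ → col ∈ M 1 a b
  C₁⊆M = there
columns≤columnBound Δ 2 _ a b submodular =
  subst (ℕ._≤ columnBound Δ) (cong suc (trans (ℕP.+-identityʳ (length C₁ ℕ.+ length C₂)) (sym (LP.length-++ C₁))))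
    (columns-bound (row₁ (a fzero) (b fzero) C₁⊆M) (row₂ (a (fsuc fzero)) (b (fsuc fzero)) C₂⊆M) (inj₁ refl))
  where
  open ColumnBound Δ (_∈ M 2 a b) (minor-bound submodular) (here refl)
  C₁ : List Col
  C₁ = colsAt 1 (a fzero) (b fzero)
  C₂ : List Col
  C₂ = colsAt 2 (a (fsuc fzero)) (b (fsuc fzero))
  C₁⊆M : ∀ {col} → col ∈ C₁ → col ∈ M 2 a b
  C₁⊆M = there ∘ ∈-++⁺ˡ
  C₂⊆M : ∀ {col} → col ∈ C₂ → col ∈ M 2 a b
  C₂⊆M = there ∘ ∈-++⁺ʳ C₁
columns≤columnBound Δ 3 _ a b submodular =
  subst (ℕ._≤ columnBound Δ) (cong suc (sym (trans (LP.length-++ (C₁ ++ C₂)) (cong (ℕ._+ length C₃) (LP.length-++ C₁)))))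
    (columns-bound (row₁ (a fzero) (b fzero) C₁⊆M) (row₂ (a (fsuc fzero)) (b (fsuc fzero)) C₂⊆M)
                   (row₃ (a (fsuc (fsuc fzero))) (b (fsuc (fsuc fzero))) C₃⊆M))
  where
  open ColumnBound Δ (_∈ M 3 a b) (minor-bound submodular) (here refl)
  C₁ : List Col
  C₁ = colsAt 1 (a fzero) (b fzero)
  C₂ : List Col
  C₂ = colsAt 2 (a (fsuc fzero)) (b (fsuc fzero))
  C₃ : List Col
  C₃ = colsAt 3 (a (fsuc (fsuc fzero))) (b (fsuc (fsuc fzero)))
  C₁⊆M : ∀ {col} → col ∈ C₁ → col ∈ M 3 a b
  C₁⊆M = there ∘ ∈-++⁺ˡ ∘ ∈-++⁺ˡ
  C₂⊆M : ∀ {col} → col ∈ C₂ → col ∈ M 3 a b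
  C₂⊆M = there ∘ ∈-++⁺ˡ ∘ ∈-++⁺ʳ C₁
  C₃⊆M : ∀ {col} → col ∈ C₃ → col ∈ M 3 a b
  C₃⊆M = there ∘ ∈-++⁺ʳ (C₁ ++ C₂)
columns≤columnBound Δ (suc (suc (suc (suc _)))) (s≤s (s≤s (s≤s ()))) a b _

corollary3p12 : (Δ : ℕ) → 1 ℕ.≤ Δ → (m : ℕ) → 1 ℕ.≤ m → m ℕ.≤ 3 → (a b : Fin m → ℤ) →
    Generic (M m a b) → Submodular Δ (M m a b) →
    ((Δ ℕ.% 6 ≡ 2 → ncols (M m a b) ℕ.≤ Δ ℕ.+ 4) ×
     ((Δ ℕ.% 6 ≡ 1 ⊎ Δ ℕ.% 6 ≡ 3 ⊎ Δ ℕ.% 6 ≡ 5) → ncols (M m a b) ℕ.≤ Δ ℕ.+ 3) ×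
     ((Δ ℕ.% 6 ≡ 0 ⊎ Δ ℕ.% 6 ≡ 4) → ncols (M m a b) ℕ.≤ Δ ℕ.+ 2))
corollary3p12 Δ _ m _ m≤3 a b _ submodular =
  at , [ at , [ at , at ]′ ]′ , [ at , at ]′
  where
  at : ∀ {r} → Δ ℕ.% 6 ≡ r → ncols (M m a b) ℕ.≤ Δ ℕ.+ β r
  at refl = columns≤columnBound Δ m m≤3 a b submodular
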